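{- Let $p$ be a prime, let $K \ge 1$, $n \ge 1$ and $j$ be integers with $0 \le j \le n-1$, and let $N = Kp^n+1$. Suppose that $N \neq p^{3(n-j)}+1$, $N \neq \left(\sqrt{p^{n-j}+1}-1\right)p^{3(n-j)}+1$, $N \neq H^3p^{3(n-j)}+1$ for every positive integer $H$, and that $p^j \ge p^{2(n-j)}$, $p^{n-j} \ge (N-1)^{2/7}$ and $p^{n-j} > 11+4\sqrt{7}$. If there exist integers $a>1$ and $L$ such that: (i) $a^{Kp^{n-j-1}} \equiv L \pmod N$ and $L \not\equiv 1 \pmod N$, and (ii) $L^{p^{j+1}} \equiv 1 \pmod N$, then $N$ is prime. -}

module Defs where

open import Level using (0ℓ)
open import Data.Nat using (ℕ)
import Data.Nat as ℕ
open import Data.Integer using (ℤ; +_)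
import Data.Integer as ℤ
open import Data.Integer.Divisibility.Signed using (_∣_)
open import Data.Rational using (ℚ; 0ℚ; _<_; _+_; _-_; _*_)
open import Data.Rational.Base using (+-*-rawSemiring)
open import Data.Rational.Literals using (fromℤ)
open import Algebra.Definitions.RawSemiring +-*-rawSemiring using (_^_)
open import Data.Product using (_×_; ∃-syntax)
open import Data.Sum using (_⊎_)
open import Relation.Nullary using (¬_)
open import Relation.Unary using (Pred; _∈_; _∉_; _⊆_; _≐_)
open import Relation.Binary.PropositionalEquality using (_≡_)

infix 4 _≡_[mod_]
_≡_[mod_] : ℤ → ℤ → ℕ → Set
x ≡ y [mod N ] = + N ∣ x ℤ.- y

-- A real number x is represented by its open lower Dedekind cut
-- { r ∈ ℚ | r < x }.  The cut axioms are not carried along; every set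
-- constructed below is such a cut under the side conditions stated.
Cut : Set₁
Cut = Pred ℚ 0ℓ

fromℕ : ℕ → ℚ
fromℕ n = fromℤ (+ n)

⟦_⟧ : ℕ → Cut
⟦ n ⟧ = λ r → r < fromℕ n

-- m^(a/b) for b ≥ 1: a rational r is below it iff r < 0 or r^b < m^a.
infixl 9 _^[_/_]
_^[_/_] : ℕ → ℕ → ℕ → Cut
m ^[ a / b ] = λ r → r < 0ℚ ⊎ r ^ b < fromℕ (m ℕ.^ a)

√_ : ℕ → Cut
√ m = m ^[ 1 / 2 ]

infixl 6 _⊕_ _⊖_
_⊕_ : Cut → ℕ → Cut
x ⊕ n = λ r → ∃[ s ] (s ∈ x × r ≡ s + fromℕ n)

_⊖_ : Cut → ℕ → Cut
x ⊖ n = λ r → ∃[ s ] (s ∈ x × r ≡ s - fromℕ n)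

-- Multiplication by a natural number c ≥ 1.
infixl 7 _⊛_
_⊛_ : Cut → ℕ → Cut
x ⊛ c = λ r → ∃[ s ] (s ∈ x × r ≡ s * fromℕ c)

infix 4 _≉ᴿ_ _≤ᴿ_ _<ᴿ_
_≉ᴿ_ : Cut → Cut → Set
x ≉ᴿ y = ¬ (x ≐ y)

_≤ᴿ_ : Cut → Cut → Set
x ≤ᴿ y = x ⊆ y

-- Some rational r satisfies x ≤ r < y.
_<ᴿ_ : Cut → Cut → Set
x <ᴿ y = ∃[ r ] (r ∉ x × r ∈ y)

{-# OPTIONS --safe #-}

-- Write d = n - j, P = p ^ d and N = 1 + M P³; the size hypotheses give M² ≤ P and P ≥ 22.
-- Some power x of L satisfies x ≢ 1, x ^ p ≡ 1 (mod N).  A prime q dividing both N and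
-- 1 + x + … + x ^ (p - 1) has x ≢ 1 (mod q), so the order of a modulo q is divisible by P,
-- and q ≡ 1 (mod P) by Fermat.  As N ≡ 1 (mod P), a composite N would be (1 + u P) (1 + h P)
-- with 1 ≤ u ≤ h.  Then u + h = s P and s + u h = M P for some s ≥ 1; with k = u s - M,
-- u² = k P + s and (u s)² ≤ 4 P.  If k = 0, then M = u³; otherwise s = 1 and k ≤ 3, where k = 1 gives
-- M = √(P + 1) - 1 while k = 2 and k = 3 contradict P ≥ 22.  These two values of
-- M are the excluded ones.
module Submission where

-- Congruences of integers modulo a natural number.

module Congruence where

  open import Defs using (_≡_[mod_])
  open import Level using (0ℓ)
  open import Algebra.Bundles using (CommutativeRing)
  open import Data.Nat.Coprimality using (coprime-divisor; gcd≡1⇒coprime)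
  open import Data.Nat as ℕ using (ℕ; zero; suc; s≤s; NonZero)
  import Data.Nat.Properties as ℕ
  import Data.Nat.Divisibility as ℕ
  open import Data.Nat.Combinatorics using (_C_; nCk+nC[k+1]≡[n+1]C[k+1]; nCn≡1; nC1≡n)
  open import Data.Nat.GCD using (GCD; gcd; gcd-GCD; gcd[m,n]∣m; gcd[m,n]∣n; gcd[m,n]≢0; module Bézout)
  open import Data.Nat.ListAction using (product)
  open import Data.Nat.Primality
  open import Data.Nat.Primality.Factorisation using (factorise)
  open import Data.Nat.Tactic.RingSolver as ℕ-Solver using ()
  open import Data.Integer using (ℤ; +_; 0ℤ; 1ℤ; _+_; _-_; _*_; -_; _^_; ∣_∣)
  import Data.Integer.Properties as ℤ
  open import Data.Integer.Divisibility.Signed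
  open import Data.Integer.Tactic.RingSolver using (solve-∀)
  open import Data.Fin using (Fin; zero; suc; toℕ; inject₁; fromℕ)
  open import Data.Fin.Properties using (toℕ-inject₁; toℕ<n; toℕ-fromℕ)
  open import Data.List using ([]; _∷_)
  open import Data.List.Relation.Unary.All using ([]; _∷_)
  open import Data.Product using (∃-syntax; _×_; _,_; proj₁; proj₂)
  open import Data.Sum using (inj₁; inj₂)
  open import Function using (_∘_)
  open import Relation.Binary.Bundles using (Setoid)
  import Relation.Binary.Reasoning.Setoid as SetoidReasoning
  open import Relation.Nullary using (¬_; Dec; yes; no; contradiction)
  open import Relation.Nullary.Decidable using (map′; decidable-stable)
  open import Relation.Binary.PropositionalEquality

  open import Algebra.Properties.Semiring.Mult ℤ.+-*-semiring using () renaming (_×_ to _·_)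
  open import Algebra.Properties.Semiring.Sum ℤ.+-*-semiring using (sum; sum-init-last)
  import Algebra.Properties.Semiring.Exp ℤ.+-*-semiring as Exp
  import Algebra.Properties.CommutativeSemiring.Binomial
    (CommutativeRing.commutativeSemiring ℤ.+-*-commutativeRing) as Binomial

  private variable
    N q : ℕ
    x y z w : ℤ

  -- A record, so that x, y and N can be inferred from the type of a congruence.
  infix 4 _≈_[mod_]
  record _≈_[mod_] (x y : ℤ) (N : ℕ) : Set where
    constructor mod
    field unmod : x ≡ y [mod N ]
  open _≈_[mod_]

  ≈-reflexive : x ≡ y → x ≈ y [mod N ]
  ≈-reflexive {x = x} refl = mod (divides 0ℤ (ℤ.+-inverseʳ x))

  ≈-sym : x ≈ y [mod N ] → y ≈ x [mod N ]
  ≈-sym {x = x} {y = y} (mod d) = mod (subst (_ ∣_) (eq x y) (∣m⇒∣-m d))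
    where
    eq : ∀ x y → - (x - y) ≡ y - x
    eq = solve-∀

  ≈-trans : x ≈ y [mod N ] → y ≈ z [mod N ] → x ≈ z [mod N ]
  ≈-trans {x = x} {y = y} {z = z} (mod d) (mod e) = mod (subst (_ ∣_) (eq x y z) (∣m∣n⇒∣m+n d e))
    where
    eq : ∀ x y z → (x - y) + (y - z) ≡ x - z
    eq = solve-∀

  ≈-setoid : ℕ → Setoid 0ℓ 0ℓ
  ≈-setoid N = record
    { _≈_ = _≈_[mod N ]
    ; isEquivalence = record { refl = ≈-reflexive refl ; sym = ≈-sym ; trans = ≈-trans }
    }

  module ≈-Reasoning (N : ℕ) = SetoidReasoning (≈-setoid N)

  +-cong : x ≈ y [mod N ] → z ≈ w [mod N ] → x + z ≈ y + w [mod N ]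
  +-cong {x = x} {y = y} {z = z} {w = w} (mod d) (mod e) =
    mod (subst (_ ∣_) (eq x y z w) (∣m∣n⇒∣m+n d e))
    where
    eq : ∀ x y z w → (x - y) + (z - w) ≡ (x + z) - (y + w)
    eq = solve-∀

  *-cong : x ≈ y [mod N ] → z ≈ w [mod N ] → x * z ≈ y * w [mod N ]
  *-cong {x = x} {y = y} {z = z} {w = w} (mod d) (mod e) =
    mod (subst (_ ∣_) (eq x y z w) (∣m∣n⇒∣m+n (∣n⇒∣m*n z d) (∣n⇒∣m*n y e)))
    where
    eq : ∀ x y z w → z * (x - y) + y * (z - w) ≡ x * z - y * w
    eq = solve-∀

  ^-cong : ∀ n → x ≈ y [mod N ] → x ^ n ≈ y ^ n [mod N ]
  ^-cong zero    d = ≈-reflexive refl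
  ^-cong (suc n) d = *-cong d (^-cong n d)

  ≈1-^ : ∀ n → x ≈ 1ℤ [mod N ] → x ^ n ≈ 1ℤ [mod N ]
  ≈1-^ n d = ≈-trans (^-cong n d) (≈-reflexive (ℤ.^-zeroˡ n))

  ^≈1-∣ : ∀ {m n} → m ℕ.∣ n → x ^ m ≈ 1ℤ [mod N ] → x ^ n ≈ 1ℤ [mod N ]
  ^≈1-∣ {x = x} {m = m} (ℕ.divides k refl) d =
    subst (_≈ 1ℤ [mod _ ]) (trans (ℤ.^-*-assoc x m k) (cong (x ^_) (ℕ.*-comm m k))) (≈1-^ k d)

  ≈-∣ : q ℕ.∣ N → x ≈ y [mod N ] → x ≈ y [mod q ]
  ≈-∣ q∣N (mod d) = mod (∣-trans (∣ᵤ⇒∣ q∣N) d)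

  -- Binomial coefficients and Fermat's little theorem.

  ^-exp : ∀ x n → x Exp.^ n ≡ x ^ n
  ^-exp x zero    = refl
  ^-exp x (suc n) = cong (x *_) (^-exp x n)

  ·≡* : ∀ n x → n · x ≡ + n * x
  ·≡* zero    x = sym (ℤ.*-zeroˡ x)
  ·≡* (suc n) x = begin
    x + n · x           ≡⟨ cong (λ y → x + y) (·≡* n x) ⟩
    x + + n * x         ≡⟨ ℤ.suc-* (+ n) x ⟨
    + suc n * x         ∎
    where open ≡-Reasoning

  -- The absorption identity, by induction through Pascal's rule; it exposes the factor `suc n` that
  -- `prime∣C` needs.
  [1+k]*[1+n]C[1+k] : ∀ n k → suc k ℕ.* (suc n C suc k) ≡ suc n ℕ.* (n C k)
  [1+k]*[1+n]C[1+k] n       zero    = begin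
    1 ℕ.* (suc n C 1)     ≡⟨ ℕ.*-identityˡ _ ⟩
    suc n C 1             ≡⟨ nC1≡n (suc n) ⟩
    suc n                 ≡⟨ ℕ.*-identityʳ _ ⟨
    suc n ℕ.* 1           ∎
    where open ≡-Reasoning
  [1+k]*[1+n]C[1+k] zero    (suc k) = ℕ.*-zeroʳ (suc (suc k))
  [1+k]*[1+n]C[1+k] (suc n) (suc k) = begin
    (2 ℕ.+ k) ℕ.* (suc (suc n) C suc (suc k))
      ≡⟨ cong ((2 ℕ.+ k) ℕ.*_) (nCk+nC[k+1]≡[n+1]C[k+1] (suc n) (suc k)) ⟨
    (2 ℕ.+ k) ℕ.* (c ℕ.+ c′)
      ≡⟨ eq₁ k c c′ ⟩
    (suc k ℕ.* c ℕ.+ c) ℕ.+ suc (suc k) ℕ.* c′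
      ≡⟨ cong₂ (λ s t → (s ℕ.+ c) ℕ.+ t) ([1+k]*[1+n]C[1+k] n k) ([1+k]*[1+n]C[1+k] n (suc k)) ⟩
    (suc n ℕ.* (n C k) ℕ.+ c) ℕ.+ suc n ℕ.* (n C suc k)
      ≡⟨ eq₂ n (n C k) c (n C suc k) ⟩
    suc n ℕ.* (n C k ℕ.+ n C suc k) ℕ.+ c
      ≡⟨ cong (λ s → suc n ℕ.* s ℕ.+ c) (nCk+nC[k+1]≡[n+1]C[k+1] n k) ⟩
    suc n ℕ.* c ℕ.+ c
      ≡⟨ ℕ.+-comm _ c ⟩
    suc (suc n) ℕ.* c ∎
    where
    open ≡-Reasoning
    c  = suc n C suc k
    c′ = suc n C suc (suc k)
    eq₁ : ∀ k c d → (2 ℕ.+ k) ℕ.* (c ℕ.+ d) ≡ (suc k ℕ.* c ℕ.+ c) ℕ.+ suc (suc k) ℕ.* d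
    eq₁ = ℕ-Solver.solve-∀
    eq₂ : ∀ n a c b → (suc n ℕ.* a ℕ.+ c) ℕ.+ suc n ℕ.* b ≡ suc n ℕ.* (a ℕ.+ b) ℕ.+ c
    eq₂ = ℕ-Solver.solve-∀

  -- By absorption `suc n` divides `suc k` times the coefficient, and it cannot divide the smaller
  -- number `suc k`.
  prime∣C : ∀ {n k} → Prime (suc n) → k ℕ.< n → suc n ℕ.∣ suc n C suc k
  prime∣C {n} {k} pr k<n
    with euclidsLemma (suc k) _ pr (ℕ.∣-trans (ℕ.m∣m*n (n C k)) (ℕ.∣-reflexive (sym ([1+k]*[1+n]C[1+k] n k))))
  ... | inj₁ d = contradiction (ℕ.∣⇒≤ d) (ℕ.<⇒≱ (s≤s k<n))
  ... | inj₂ d = d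

  ∣sum : ∀ {k n} (f : Fin n → ℤ) → (∀ i → k ∣ f i) → k ∣ sum f
  ∣sum {k} {zero}  f h = divides 0ℤ (sym (ℤ.*-zeroˡ k))
  ∣sum {k} {suc n} f h = ∣m∣n⇒∣m+n (h zero) (∣sum (f ∘ suc) (h ∘ suc))

  freshman : Prime q → ∀ x → (x + 1ℤ) ^ q ≈ x ^ q + 1ℤ [mod q ]
  freshman {zero}  pr x = contradiction refl (ℕ.≢-nonZero⁻¹ 0 {{prime⇒nonZero pr}})
  freshman {suc n} pr x = mod (subst (+ suc n ∣_) (sym diff) (∣sum middle middle-divisible))
    where
    term = Binomial.binomialTerm x 1ℤ (suc n)
    -- `suc` skips the term `1` and `inject₁` the term `x ^ suc n`; `prime∣C` applies to every index
    -- in between.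
    middle : Fin n → ℤ
    middle i = term (suc (inject₁ i))
    middle-divisible : ∀ i → + suc n ∣ middle i
    middle-divisible i = subst (+ suc n ∣_) (sym (·≡* c _)) (∣m⇒∣m*n _ (∣ᵤ⇒∣ {i = + c}
        (prime∣C pr (subst (ℕ._< n) (sym (toℕ-inject₁ i)) (toℕ<n i)))))
      where c = suc n C suc (toℕ (inject₁ i))
    first : term zero ≡ 1ℤ
    first = begin
      1ℤ * 1ℤ Exp.^ suc n + 0ℤ  ≡⟨ ℤ.+-identityʳ _ ⟩
      1ℤ * 1ℤ Exp.^ suc n       ≡⟨ ℤ.*-identityˡ _ ⟩
      1ℤ Exp.^ suc n            ≡⟨ ^-exp 1ℤ (suc n) ⟩
      1ℤ ^ suc n                ≡⟨ ℤ.^-zeroˡ (suc n) ⟩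
      1ℤ                        ∎
      where open ≡-Reasoning
    last : term (fromℕ (suc n)) ≡ x ^ suc n
    last = begin
      (suc n C k) · (x Exp.^ k * 1ℤ Exp.^ (suc n ℕ.∸ k))
        ≡⟨ cong (λ k → (suc n C k) · (x Exp.^ k * 1ℤ Exp.^ (suc n ℕ.∸ k))) (toℕ-fromℕ (suc n)) ⟩
      (suc n C suc n) · (x Exp.^ suc n * 1ℤ Exp.^ (n ℕ.∸ n))
        ≡⟨ cong₂ (λ c e → c · (x Exp.^ suc n * 1ℤ Exp.^ e)) (nCn≡1 (suc n)) (ℕ.n∸n≡0 n) ⟩
      x Exp.^ suc n * 1ℤ + 0ℤ
        ≡⟨ trans (ℤ.+-identityʳ _) (ℤ.*-identityʳ _) ⟩
      x Exp.^ suc n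
        ≡⟨ ^-exp x (suc n) ⟩
      x ^ suc n ∎
      where
      open ≡-Reasoning
      k = toℕ (fromℕ (suc n))
    diff : (x + 1ℤ) ^ suc n - (x ^ suc n + 1ℤ) ≡ sum middle
    diff = begin
      (x + 1ℤ) ^ suc n - (x ^ suc n + 1ℤ)
        ≡⟨ cong (_- (x ^ suc n + 1ℤ)) (trans (sym (^-exp (x + 1ℤ) (suc n))) (Binomial.theorem (suc n) x 1ℤ)) ⟩
      (term zero + sum (term ∘ suc)) - (x ^ suc n + 1ℤ)
        ≡⟨ cong (λ s → (term zero + s) - (x ^ suc n + 1ℤ)) (sum-init-last (term ∘ suc)) ⟩
      (term zero + (sum middle + term (fromℕ (suc n)))) - (x ^ suc n + 1ℤ)
        ≡⟨ cong₂ (λ s t → (s + (sum middle + t)) - (x ^ suc n + 1ℤ)) first last ⟩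
      (1ℤ + (sum middle + x ^ suc n)) - (x ^ suc n + 1ℤ)
        ≡⟨ eq (sum middle) (x ^ suc n) ⟩
      sum middle ∎
      where
      open ≡-Reasoning
      eq : ∀ m y → (1ℤ + (m + y)) - (y + 1ℤ) ≡ m
      eq = solve-∀

  fermat : Prime q → ∀ n → (+ n) ^ q ≈ + n [mod q ]
  fermat {zero}  pr _       = contradiction refl (ℕ.≢-nonZero⁻¹ 0 {{prime⇒nonZero pr}})
  fermat {suc q} pr zero    = ≈-reflexive refl
  fermat {suc q} pr (suc n) = begin
    (+ suc n) ^ suc q     ≡⟨ cong (_^ suc q) n+1 ⟨
    (+ n + 1ℤ) ^ suc q    ≈⟨ freshman pr (+ n) ⟩
    (+ n) ^ suc q + 1ℤ    ≈⟨ +-cong (fermat pr n) (≈-reflexive refl) ⟩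
    + n + 1ℤ              ≡⟨ n+1 ⟩
    + suc n               ∎
    where
    open ≈-Reasoning (suc q)
    n+1 : + n + 1ℤ ≡ + suc n
    n+1 = cong +_ (ℕ.+-comm n 1)

  -- The congruence `n ^ suc m ≈ 1` provides `n ^ m` as an inverse of `n`, which cancels one factor
  -- from Fermat's `n ^ q ≈ n`.
  fermat-unit : Prime q → ∀ n m → (+ n) ^ suc m ≈ 1ℤ [mod q ] → (+ n) ^ (q ℕ.∸ 1) ≈ 1ℤ [mod q ]
  fermat-unit {zero}  pr _ _ _ = contradiction refl (ℕ.≢-nonZero⁻¹ 0 {{prime⇒nonZero pr}})
  fermat-unit {suc q} pr n m unit = begin
    a ^ q                ≡⟨ ℤ.*-identityˡ (a ^ q) ⟨
    1ℤ * a ^ q           ≈⟨ *-cong unit (≈-reflexive refl) ⟨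
    (a * a ^ m) * a ^ q  ≡⟨ eq a (a ^ m) (a ^ q) ⟩
    a ^ m * a ^ suc q    ≈⟨ *-cong (≈-reflexive {x = a ^ m} refl) (fermat pr n) ⟩
    a ^ m * a            ≡⟨ ℤ.*-comm (a ^ m) a ⟩
    a ^ suc m            ≈⟨ unit ⟩
    1ℤ                   ∎
    where
    open ≈-Reasoning (suc q)
    a = + n
    eq : ∀ a b c → (a * b) * c ≡ b * (a * c)
    eq = solve-∀

  -- Multiplicative orders, and a prime factor congruent to 1 modulo `p ^ suc e`.

  -- Bézout's identity over the naturals reads `d + t n = s m` or `d + s m = t n`, so `x ^ d` times
  -- a trivial power is a trivial power and no negative exponent occurs.
  ^-gcd≈1 : ∀ {d m n} → GCD m n d →
    x ^ m ≈ 1ℤ [mod N ] → x ^ n ≈ 1ℤ [mod N ] → x ^ d ≈ 1ℤ [mod N ]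
  ^-gcd≈1 {x = x} {N = N} {d} {m} {n} g hm hn = bézout (Bézout.identity g)
    where
    open ≈-Reasoning N
    cancel : ∀ e f → d ℕ.+ e ≡ f →
      x ^ e ≈ 1ℤ [mod N ] → x ^ f ≈ 1ℤ [mod N ] → x ^ d ≈ 1ℤ [mod N ]
    cancel e f refl he hf = begin
      x ^ d             ≡⟨ ℤ.*-identityʳ _ ⟨
      x ^ d * 1ℤ        ≈⟨ *-cong (≈-reflexive {x = x ^ d} refl) he ⟨
      x ^ d * x ^ e     ≡⟨ ℤ.^-distribˡ-+-* x d e ⟨
      x ^ (d ℕ.+ e)     ≈⟨ hf ⟩
      1ℤ                ∎
    bézout : Bézout.Identity d m n → x ^ d ≈ 1ℤ [mod N ]
    bézout (Bézout.+- s t eq) = cancel _ _ eq (^≈1-∣ (ℕ.n∣m*n t) hn) (^≈1-∣ (ℕ.n∣m*n s) hm)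
    bézout (Bézout.-+ s t eq) = cancel _ _ eq (^≈1-∣ (ℕ.n∣m*n s) hm) (^≈1-∣ (ℕ.n∣m*n t) hn)

  -- If p ∤ c in p * E = g * c, where g = gcd m (p * E), then p ^ suc e divides g, hence m.
  ∤⇒gcd∣ : ∀ {p m E} e → Prime p → p ℕ.^ e ℕ.∣ E → ¬ p ℕ.^ suc e ℕ.∣ m → gcd m (p ℕ.* E) ℕ.∣ E
  ∤⇒gcd∣ {p} {m} {E} e pr pᵉ∣E ∤m with gcd[m,n]∣n m (p ℕ.* E)
  ... | ℕ.divides c pE≡cg with p ℕ.∣? c
  ...   | yes (ℕ.divides c′ refl) = ℕ.divides c′ (ℕ.*-cancelˡ-≡ E _ p {{prime⇒nonZero pr}} (begin
      p ℕ.* E                  ≡⟨ pE≡cg ⟩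
      (c′ ℕ.* p) ℕ.* g         ≡⟨ cong (ℕ._* g) (ℕ.*-comm c′ p) ⟩
      (p ℕ.* c′) ℕ.* g         ≡⟨ ℕ.*-assoc p c′ g ⟩
      p ℕ.* (c′ ℕ.* g)         ∎))
    where
    open ≡-Reasoning
    g = gcd m (p ℕ.* E)
  ...   | no p∤c = contradiction
      (ℕ.∣-trans (prime-power∣ (suc e) p∤c (subst (p ℕ.^ suc e ℕ.∣_) pE≡cg (ℕ.*-monoʳ-∣ p pᵉ∣E)))
                 (gcd[m,n]∣m m (p ℕ.* E))) ∤m
    where
    prime-power∣ : ∀ {c g} e → ¬ p ℕ.∣ c → p ℕ.^ e ℕ.∣ c ℕ.* g → p ℕ.^ e ℕ.∣ g
    prime-power∣ {c} {g} zero    p∤c _ = ℕ.1∣ g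
    prime-power∣ {c} {g} (suc e) p∤c d with euclidsLemma c g pr (ℕ.∣-trans (ℕ.m∣m*n (p ℕ.^ e)) d)
    ... | inj₁ p∣c = contradiction p∣c p∤c
    ... | inj₂ (ℕ.divides h refl) = subst (p ℕ.^ suc e ℕ.∣_) (ℕ.*-comm p h)
      (ℕ.*-monoʳ-∣ p (prime-power∣ e p∤c (ℕ.*-cancelˡ-∣ p {{prime⇒nonZero pr}}
        (subst (p ℕ.^ suc e ℕ.∣_) (eq c h p) d))))
      where
      eq : ∀ c h p → c ℕ.* (h ℕ.* p) ≡ p ℕ.* (c ℕ.* h)
      eq = ℕ-Solver.solve-∀

  -- The sum `1 + x + … + x ^ (n - 1)` in Horner form.
  geometric : ℤ → ℕ → ℤ
  geometric x zero    = 0ℤ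
  geometric x (suc n) = 1ℤ + x * geometric x n

  geometric-* : ∀ x n → geometric x n * (x - 1ℤ) ≡ x ^ n - 1ℤ
  geometric-* x zero    = ℤ.*-zeroˡ (x - 1ℤ)
  geometric-* x (suc n) = begin
    (1ℤ + x * geometric x n) * (x - 1ℤ)          ≡⟨ eq₁ x (geometric x n) ⟩
    x - 1ℤ + x * (geometric x n * (x - 1ℤ))      ≡⟨ cong (λ s → x - 1ℤ + x * s) (geometric-* x n) ⟩
    x - 1ℤ + x * (x ^ n - 1ℤ)                    ≡⟨ eq₂ x (x ^ n) ⟩
    x * x ^ n - 1ℤ                               ∎
    where
    open ≡-Reasoning
    eq₁ : ∀ x g → (1ℤ + x * g) * (x - 1ℤ) ≡ x - 1ℤ + x * (g * (x - 1ℤ))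
    eq₁ = solve-∀
    eq₂ : ∀ x y → x - 1ℤ + x * (y - 1ℤ) ≡ x * y - 1ℤ
    eq₂ = solve-∀

  geometric-≈ : ∀ n → x ≈ 1ℤ [mod N ] → geometric x n ≈ + n [mod N ]
  geometric-≈ {x = x} zero    h = ≈-reflexive refl
  geometric-≈ {x = x} {N = N} (suc n) h = begin
    1ℤ + x * geometric x n   ≈⟨ +-cong (≈-reflexive {x = 1ℤ} refl) (*-cong h (geometric-≈ n h)) ⟩
    1ℤ + 1ℤ * + n            ≡⟨ cong (λ s → 1ℤ + s) (ℤ.*-identityˡ (+ n)) ⟩
    + suc n                  ∎
    where open ≈-Reasoning N

  ∃-prime-∣ : ∀ n → n ≢ 0 → n ≢ 1 → ∃[ q ] (Prime q × q ℕ.∣ n)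
  ∃-prime-∣ n n≢0 n≢1 with factorise n {{ℕ.≢-nonZero n≢0}}
  ... | record { factors = [] ; isFactorisation = n≡1 } = contradiction n≡1 n≢1
  ... | record { factors = q ∷ qs ; isFactorisation = n≡ ; factorsPrime = pr ∷ _ } =
    q , pr , subst (q ℕ.∣_) (sym n≡) (ℕ.m∣m*n (product qs))

  -- As x ^ p - 1 = (x - 1) * geometric x p, a common prime factor r of N and geometric x p exists;
  -- if x were 1 modulo r, then geometric x p would be p.
  order-prime-factor : ∀ {p} → N ≢ 0 → Prime p → ¬ p ℕ.∣ N → x ^ p ≈ 1ℤ [mod N ] → ¬ x ≈ 1ℤ [mod N ] →
                       ∃[ q ] (Prime q × q ℕ.∣ N × ¬ x ≈ 1ℤ [mod q ])
  order-prime-factor {N} {x} {p} N≢0 pr p∤N xᵖ≈1 x≉1 =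
    r , r-prime , ℕ.∣-trans r∣g (gcd[m,n]∣m N S) , λ x≈1 → r∤p (r∣p x≈1)
    where
    S = ∣ geometric x p ∣
    g = gcd N S
    -- `N` divides `x ^ p - 1 = geometric x p * (x - 1)`; if it were coprime to the first factor, it
    -- would divide `x - 1`.
    g≢1 : g ≢ 1
    g≢1 g≡1 = x≉1 (mod (∣ᵤ⇒∣ (coprime-divisor {N} {S} (gcd≡1⇒coprime g≡1)
      (subst (N ℕ.∣_) (trans (cong ∣_∣ (sym (geometric-* x p))) (ℤ.abs-* (geometric x p) (x - 1ℤ)))
        (∣⇒∣ᵤ (unmod xᵖ≈1))))))
    factor = ∃-prime-∣ g (gcd[m,n]≢0 N S (inj₁ N≢0)) g≢1
    r = proj₁ factor
    r-prime = proj₁ (proj₂ factor)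
    r∣g : r ℕ.∣ g
    r∣g = proj₂ (proj₂ factor)
    r∣p : x ≈ 1ℤ [mod r ] → r ℕ.∣ p
    r∣p x≈1 = ∣⇒∣ᵤ {+ r} {+ p} (subst (+ r ∣_) (eq (geometric x p) (+ p))
      (∣m∣n⇒∣m-n (∣ᵤ⇒∣ {+ r} {geometric x p} (ℕ.∣-trans r∣g (gcd[m,n]∣n N S)))
                 (unmod (geometric-≈ p x≈1))))
      where
      eq : ∀ s t → s - (s - t) ≡ t
      eq = solve-∀
    r∤p : ¬ r ℕ.∣ p
    r∤p d with prime⇒irreducible pr d
    ... | inj₁ r≡1 = contradiction r≡1 (ℕ.nonTrivial⇒≢1 {{prime⇒nonTrivial r-prime}})
    ... | inj₂ r≡p = p∤N (subst (ℕ._∣ N) r≡p (ℕ.∣-trans r∣g (gcd[m,n]∣m N S)))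

  ≈1? : ∀ x N → Dec (x ≈ 1ℤ [mod N ])
  ≈1? x N = map′ mod unmod (+ N ∣? x - 1ℤ)

  -- A downward search from `p ^ m`: the powers cannot stay trivial down to `p ^ 0`, because `x` is
  -- not 1. The power found is nontrivial modulo `N`, but its `p`-th power is trivial.
  last-nontrivial-power : ∀ {p} m → ¬ x ≈ 1ℤ [mod N ] → x ^ (p ℕ.^ m) ≈ 1ℤ [mod N ] →
    ∃[ i ] (¬ x ^ (p ℕ.^ i) ≈ 1ℤ [mod N ] × x ^ (p ℕ.^ suc i) ≈ 1ℤ [mod N ])
  last-nontrivial-power {x = x} zero x≉1 h =
    contradiction (subst (_≈ 1ℤ [mod _ ]) (ℤ.^-identityʳ x) h) x≉1
  last-nontrivial-power {x = x} {N = N} {p = p} (suc m) x≉1 h with ≈1? (x ^ (p ℕ.^ m)) N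
  ... | yes h′ = last-nontrivial-power m x≉1 h′
  ... | no  h′ = m , h′ , h

  ^-*-assoc′ : ∀ x m n → x ^ (m ℕ.* n) ≡ (x ^ n) ^ m
  ^-*-assoc′ x m n = trans (cong (x ^_) (ℕ.*-comm m n)) (sym (ℤ.^-*-assoc x n m))

  -- gcd (q - 1) (p * E) divides E unless p ^ suc e divides q - 1.
  order-∣ : ∀ {p} a e E → .{{NonZero E}} → Prime p → Prime q → p ℕ.^ e ℕ.∣ E →
    ¬ (+ a) ^ E ≈ 1ℤ [mod q ] → (+ a) ^ (p ℕ.* E) ≈ 1ℤ [mod q ] → p ℕ.^ suc e ℕ.∣ q ℕ.∸ 1
  order-∣ {q} {p} a e E pr q-prime pᵉ∣E ≉1 ≈1 = decidable-stable (p ℕ.^ suc e ℕ.∣? q ℕ.∸ 1) λ ∤q-1 →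
    ≉1 (^≈1-∣ (∤⇒gcd∣ e pr pᵉ∣E ∤q-1) (^-gcd≈1 (gcd-GCD (q ℕ.∸ 1) (p ℕ.* E)) aᑫ⁻¹≈1 ≈1))
    where
    instance
      pE≢0 : NonZero (p ℕ.* E)
      pE≢0 = ℕ.m*n≢0 p E {{prime⇒nonZero pr}}
    -- As `p * E` is positive, `a ^ (p * E) ≈ 1` makes `a` a unit modulo `q`, which this form of
    -- Fermat's theorem requires.
    aᑫ⁻¹≈1 : (+ a) ^ (q ℕ.∸ 1) ≈ 1ℤ [mod q ]
    aᑫ⁻¹≈1 = fermat-unit q-prime a (ℕ.pred (p ℕ.* E))
      (subst (λ n → (+ a) ^ n ≈ 1ℤ [mod q ]) (sym (ℕ.suc-pred (p ℕ.* E))) ≈1)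

  -- The last nontrivial power `L ^ (p ^ i)` of `L = a ^ (c * p ^ e)` yields `q`. It equals `a ^ E`
  -- with `p ^ e` dividing `E`, so `order-∣` gains one more factor `p` in `q - 1`.
  ∃-prime-factor-≡1 : ∀ {p} a c e m → .{{NonZero c}} → N ≢ 0 → Prime p → ¬ p ℕ.∣ N →
    ¬ (+ a) ^ (c ℕ.* p ℕ.^ e) ≈ 1ℤ [mod N ] →
    ((+ a) ^ (c ℕ.* p ℕ.^ e)) ^ (p ℕ.^ m) ≈ 1ℤ [mod N ] →
    ∃[ q ] (Prime q × q ℕ.∣ N × p ℕ.^ suc e ℕ.∣ q ℕ.∸ 1)
  ∃-prime-factor-≡1 {N} {p} a c e m {{c≢0}} N≢0 pr p∤N L≉1 Lᵖᵐ≈1 =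
    let i , ≉1 , ≈1 = last-nontrivial-power m L≉1 Lᵖᵐ≈1
        q , q-prime , q∣N , x≉1 = order-prime-factor N≢0 pr p∤N
          (subst (_≈ 1ℤ [mod N ]) (^-*-assoc′ L p (p ℕ.^ i)) ≈1) ≉1
        E = (c ℕ.* p ℕ.^ e) ℕ.* p ℕ.^ i
        instance E≢0 = ℕ.m*n≢0 _ _ {{ℕ.m*n≢0 c _ {{c≢0}} {{ℕ.m^n≢0 p e {{p≢0}}}}}} {{ℕ.m^n≢0 p i {{p≢0}}}}
        aᴱ≡ = ℤ.^-*-assoc (+ a) (c ℕ.* p ℕ.^ e) (p ℕ.^ i)
    in q , q-prime , q∣N , order-∣ a e E pr q-prime (ℕ.∣-trans (ℕ.n∣m*n c) (ℕ.m∣m*n (p ℕ.^ i)))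
         (λ h → x≉1 (subst (_≈ 1ℤ [mod q ]) (sym aᴱ≡) h))
         (≈-∣ q∣N (subst (_≈ 1ℤ [mod N ])
           (trans (^-*-assoc′ L p (p ℕ.^ i)) (trans (cong (λ y → y ^ p) aᴱ≡) (sym (^-*-assoc′ (+ a) p E)))) ≈1))
    where
    L = (+ a) ^ (c ℕ.* p ℕ.^ e)
    p≢0 = prime⇒nonZero pr

-- Factorisations of `1 + M P³` into two factors congruent to 1 modulo `P`.

module Factorisation where

  open import Data.Nat
  open import Data.Nat.Properties
  open import Data.Nat.Divisibility
  open import Data.Nat.Tactic.RingSolver using (solve-∀)
  open import Data.Product using (∃-syntax; _×_; _,_)
  open import Data.Sum using (_⊎_; inj₁; inj₂)
  open import Relation.Nullary using (¬_; yes; no; contradiction)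
  open import Relation.Binary.PropositionalEquality

  square-mono : ∀ {m n} → m ≤ n → m * m ≤ n * n
  square-mono h = *-mono-≤ h h

  module _ {M P : ℕ} (M≥1 : M ≥ 1) (M²≤P : M * M ≤ P) (P≥22 : P ≥ 22) where

    -- The shapes of `M` that the theorem excludes; the second is `M = √(P + 1) - 1` with the root
    -- cleared.
    Exceptional : Set
    Exceptional = (∃[ H ] (H ≥ 1 × M ≡ H * H * H)) ⊎ (suc M * suc M ≡ P + 1)

    private
      M≤4-absurd : M ≤ 4 → ¬ P ≤ 4 * M + 3
      M≤4-absurd M≤4 h = <⇒≱ P≥22 (≤-trans h (≤-trans (+-monoˡ-≤ 3 (*-monoʳ-≤ 4 M≤4)) (m≤m+n 19 2)))

      -- The cases `k = 2` and `k = 3` of `root-case` reduce to this. For `M ≥ 5` it follows from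
      -- `4 M + 3 < 5 M ≤ M² ≤ P`, and for `M ≤ 4` from `19 < 22 ≤ P`.
      P≰4M+3 : ¬ P ≤ 4 * M + 3
      P≰4M+3 h with M ≤? 4
      ... | yes M≤4 = M≤4-absurd M≤4 h
      ... | no M≰4 = <⇒≱ (begin-strict
        4 * M + 3     <⟨ +-monoʳ-< (4 * M) (≤-trans (m≤m+n 4 1) (≰⇒> M≰4)) ⟩
        4 * M + M     ≡⟨ eq M ⟩
        5 * M         ≤⟨ *-monoˡ-≤ M (≰⇒> M≰4) ⟩
        M * M         ≤⟨ M²≤P ⟩
        P             ∎) h
        where
        open ≤-Reasoning
        eq : ∀ m → 4 * m + m ≡ 5 * m
        eq = solve-∀

    -- u² = k P + s with s = 1 and u = M + k
    root-case : ∀ k → (M + k) * (M + k) ≡ k * P + 1 → k ≥ 1 → k ≤ 3 → Exceptional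
    root-case 1 eq _ _ = inj₂ (trans (cong (λ m → m * m) (+-comm 1 M))
      (trans eq (cong (_+ 1) (*-identityˡ P))))
    root-case 2 eq _ _ = contradiction (+-cancelˡ-≤ (P + 1) P _ (begin
      P + 1 + P           ≡⟨ e₁ P ⟩
      2 * P + 1           ≡⟨ eq ⟨
      (M + 2) * (M + 2)   ≡⟨ e₂ M ⟩
      M * M + (4 * M + 4) ≤⟨ +-monoˡ-≤ _ M²≤P ⟩
      P + (4 * M + 4)     ≡⟨ e₃ P M ⟩
      P + 1 + (4 * M + 3) ∎)) P≰4M+3
      where
      open ≤-Reasoning
      e₁ : ∀ p → p + 1 + p ≡ 2 * p + 1
      e₁ = solve-∀
      e₂ : ∀ m → (m + 2) * (m + 2) ≡ m * m + (4 * m + 4)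
      e₂ = solve-∀
      e₃ : ∀ p m → p + (4 * m + 4) ≡ p + 1 + (4 * m + 3)
      e₃ = solve-∀
    root-case 3 eq _ _ = contradiction (*-cancelˡ-≤ 2 (+-cancelˡ-≤ (P + 1) _ _ (begin
      P + 1 + 2 * P         ≡⟨ e₁ P ⟩
      3 * P + 1             ≡⟨ eq ⟨
      (M + 3) * (M + 3)     ≡⟨ e₂ M ⟩
      M * M + (6 * M + 9)     ≤⟨ +-monoˡ-≤ _ M²≤P ⟩
      P + (6 * M + 9)         ≡⟨ e₃ P M ⟩
      -- Raising the constant `2` to `2 * M` turns the bound into twice `4 * M + 3`, so that the
      -- factor 2 cancels.
      P + 1 + (6 * M + 6 + 2) ≤⟨ +-monoʳ-≤ (P + 1) (+-monoʳ-≤ (6 * M + 6) (*-monoʳ-≤ 2 M≥1)) ⟩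
      P + 1 + (6 * M + 6 + 2 * M) ≡⟨ e₄ P M ⟩
      P + 1 + 2 * (4 * M + 3) ∎))) P≰4M+3
      where
      open ≤-Reasoning
      e₁ : ∀ p → p + 1 + 2 * p ≡ 3 * p + 1
      e₁ = solve-∀
      e₂ : ∀ m → (m + 3) * (m + 3) ≡ m * m + (6 * m + 9)
      e₂ = solve-∀
      e₃ : ∀ p m → p + (6 * m + 9) ≡ p + 1 + (6 * m + 6 + 2)
      e₃ = solve-∀
      e₄ : ∀ p m → p + 1 + (6 * m + 6 + 2 * m) ≡ p + 1 + 2 * (4 * m + 3)
      e₄ = solve-∀
    root-case (suc (suc (suc (suc k)))) _ _ (s≤s (s≤s (s≤s ())))

    -- u and h are the roots of X² - s P X + (M P - s).
    quadratic-case : ∀ u h s → u ≥ 1 → u ≤ h → u + h ≡ s * P → s + u * h ≡ M * P → Exceptional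
    quadratic-case (suc u) h zero _ _ () _
    -- The truncated difference is the `k` of the case analysis; it is exact because of `M≤us`.
    quadratic-case u h s@(suc s-1) u≥1 u≤h sum prod = split (u * s ∸ M) refl
      where
      open ≤-Reasoning
      instance _ = >-nonZero (≤-trans (s≤s z≤n) P≥22)

      -- As `u` is the smaller root, `u` times the sum of the roots is at most twice their product.
      us≤2M : u * s ≤ 2 * M
      us≤2M = *-cancelʳ-≤ _ _ P (begin
        u * s * P           ≡⟨ *-assoc u s P ⟩
        u * (s * P)         ≡⟨ cong (u *_) sum ⟨
        u * (u + h)         ≤⟨ *-monoʳ-≤ u (+-monoˡ-≤ h u≤h) ⟩
        u * (h + h)         ≡⟨ e u h ⟩
        2 * (u * h)         ≤⟨ *-monoʳ-≤ 2 (m≤n+m (u * h) s) ⟩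
        2 * (s + u * h)     ≡⟨ cong (2 *_) prod ⟩
        2 * (M * P)         ≡⟨ *-assoc 2 M P ⟨
        2 * M * P           ∎)
        where
        e : ∀ u h → u * (h + h) ≡ 2 * (u * h)
        e = solve-∀

      u²s²≤4P : u * s * (u * s) ≤ 4 * P
      u²s²≤4P = begin
        u * s * (u * s)     ≤⟨ square-mono us≤2M ⟩
        2 * M * (2 * M)     ≡⟨ e M ⟩
        4 * (M * M)         ≤⟨ *-monoʳ-≤ 4 M²≤P ⟩
        4 * P               ∎
        where
        e : ∀ m → 2 * m * (2 * m) ≡ 4 * (m * m)
        e = solve-∀

      -- Eliminates `h` from the sum and the product; kept additive, because subtraction on the
      -- naturals truncates.
      root : u * u + M * P ≡ u * s * P + s
      root = begin-equality
        u * u + M * P        ≡⟨ cong (u * u +_) prod ⟨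
        u * u + (s + u * h)  ≡⟨ e u h s ⟩
        u * (u + h) + s      ≡⟨ cong (λ t → u * t + s) sum ⟩
        u * (s * P) + s      ≡⟨ cong (_+ s) (*-assoc u s P) ⟨
        u * s * P + s        ∎
        where
        e : ∀ u h s → u * u + (s + u * h) ≡ u * (u + h) + s
        e = solve-∀

      -- `s ≤ u s` turns `P ≤ s` into `P² ≤ 4 P`, hence `P ≤ 4`.
      P≰s : ¬ P ≤ s
      P≰s P≤s = <⇒≱ P≥22 (≤-trans (*-cancelʳ-≤ P 4 P (begin
        P * P               ≤⟨ square-mono P≤s ⟩
        s * s               ≤⟨ square-mono (m≤n*m s u {{>-nonZero u≥1}}) ⟩
        u * s * (u * s)     ≤⟨ u²s²≤4P ⟩
        4 * P               ∎)) (m≤m+n 4 17))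

      -- If `u * s < M`, the left side of `root` has an extra `P` that `s` would have to absorb,
      -- against `P≰s`.
      M≤us : M ≤ u * s
      M≤us with M ≤? u * s
      ... | yes M≤us = M≤us
      ... | no M≰us = contradiction (+-cancelˡ-≤ (u * s * P) P s (begin
        u * s * P + P           ≡⟨ +-comm _ P ⟩
        suc (u * s) * P         ≤⟨ *-monoˡ-≤ P (≰⇒> M≰us) ⟩
        M * P                   ≤⟨ m≤n+m (M * P) (u * u) ⟩
        u * u + M * P           ≡⟨ root ⟩
        u * s * P + s           ∎)) P≰s

      split : ∀ k → u * s ∸ M ≡ k → Exceptional
      split k eq = cases k s-1 refl us≡ u²≡
        where
        us≡ : u * s ≡ M + k
        us≡ = trans (sym (m+[n∸m]≡n M≤us)) (cong (M +_) eq)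
        u²≡ : u * u ≡ k * P + s
        u²≡ = +-cancelʳ-≡ (M * P) _ _ (begin-equality
          u * u + M * P         ≡⟨ root ⟩
          u * s * P + s         ≡⟨ cong (λ t → t * P + s) us≡ ⟩
          (M + k) * P + s       ≡⟨ e M k P s ⟩
          k * P + s + M * P     ∎)
          where
          e : ∀ m k p s → (m + k) * p + s ≡ k * p + s + m * p
          e = solve-∀
        -- `t` is `s - 1`, so the patterns `zero` and `suc t` stand for `s = 1` and `s ≥ 2`.
        cases : ∀ k t → t ≡ s-1 → u * s ≡ M + k → u * u ≡ k * P + s → Exceptional
        cases zero    _ _ us≡ u²≡ = inj₁ (u , u≥1 , (begin-equality
          M             ≡⟨ +-identityʳ M ⟨
          M + 0         ≡⟨ us≡ ⟨
          u * s         ≡⟨ cong (u *_) u²≡ ⟨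
          u * (u * u)   ≡⟨ *-assoc u u u ⟨
          u * u * u     ∎))
        cases k@(suc k-1) zero refl us≡ u²≡ = root-case k
          (trans (cong (λ t → t * t) (trans (sym us≡) (*-identityʳ u))) u²≡) (s≤s z≤n) k≤3
          where
          k≤3 : k ≤ 3
          k≤3 with k ≤? 3
          ... | yes k≤3 = k≤3
          ... | no k≰3 = contradiction (begin
            suc (4 * P)         ≤⟨ s≤s (*-monoˡ-≤ P (≰⇒> k≰3)) ⟩
            suc (k * P)         ≡⟨ +-comm 1 (k * P) ⟩
            k * P + 1           ≡⟨ u²≡ ⟨
            u * u               ≡⟨ cong (λ t → t * t) (*-identityʳ u) ⟨
            u * 1 * (u * 1)     ≤⟨ u²s²≤4P ⟩
            4 * P               ∎) (n≮n (4 * P))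
        -- For `s ≥ 2`, `4 u² ≤ (u s)² ≤ 4 P` gives `u² ≤ P`, while `u²` is at least `P + s`.
        cases (suc k) (suc t) refl us≡ u²≡ = contradiction (begin
          P + s                 ≤⟨ +-monoˡ-≤ s (m≤m+n P (k * P)) ⟩
          suc k * P + s         ≡⟨ u²≡ ⟨
          u * u                 ≤⟨ *-cancelˡ-≤ 4 (begin
            4 * (u * u)           ≡⟨ e u ⟩
            u * 2 * (u * 2)       ≤⟨ square-mono (*-monoʳ-≤ u (s≤s (s≤s z≤n))) ⟩
            u * s * (u * s)       ≤⟨ u²s²≤4P ⟩
            4 * P                 ∎) ⟩
          P                     ∎) (m+1+n≰m P)
          where
          e : ∀ u → 4 * (u * u) ≡ u * 2 * (u * 2)
          e = solve-∀

    -- Expanding and cancelling `P` leaves `u + h + u h P = M P²`, so `P` divides `u + h`; writing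
    -- `u + h = s P` and cancelling `P` again gives the product equation of `quadratic-case`.
    ordered-factorisation : ∀ u h → u ≥ 1 → u ≤ h →
      (1 + u * P) * (1 + h * P) ≡ 1 + M * (P * P * P) → Exceptional
    ordered-factorisation u h u≥1 u≤h eq = quadratic-case u h s u≥1 u≤h u+h≡sP
      (*-cancelʳ-≡ _ _ P (trans (*-distribʳ-+ P s (u * h))
        (trans (cong (_+ u * h * P) (sym u+h≡sP)) eq′)))
      where
      instance _ = >-nonZero (≤-trans (s≤s z≤n) P≥22)
      eq′ : u + h + u * h * P ≡ M * P * P
      eq′ = *-cancelʳ-≡ _ _ P (suc-injective (trans (e₁ u h P) (trans eq (cong suc (e₂ M P)))))
        where
        e₁ : ∀ u h p → 1 + (u + h + u * h * p) * p ≡ (1 + u * p) * (1 + h * p)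
        e₁ = solve-∀
        e₂ : ∀ m p → m * (p * p * p) ≡ m * p * p * p
        e₂ = solve-∀
      P∣u+h : P ∣ u + h
      P∣u+h = ∣m+n∣m⇒∣n (subst (P ∣_) (trans (sym eq′) (+-comm (u + h) _)) (n∣m*n (M * P))) (n∣m*n (u * h))
      s = quotient P∣u+h
      u+h≡sP = m∣n⇒n≡quotient*m P∣u+h

    factorisation⇒exceptional : ∀ u h → u ≥ 1 → h ≥ 1 →
      (1 + u * P) * (1 + h * P) ≡ 1 + M * (P * P * P) → Exceptional
    factorisation⇒exceptional u h u≥1 h≥1 eq with ≤-total u h
    ... | inj₁ u≤h = ordered-factorisation u h u≥1 u≤h eq
    ... | inj₂ h≤u = ordered-factorisation h u h≥1 h≤u (trans (*-comm (1 + h * P) _) eq)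

-- Dedekind cuts compared with natural numbers.

module RealCut where

  open import Defs
  open import Data.Nat as ℕ using (ℕ; zero; suc; NonZero; s≤s; z≤n)
  import Data.Nat.Properties as ℕ
  open import Data.Integer using (+_)
  import Data.Integer as ℤ
  import Data.Integer.Properties as ℤ
  open import Data.Rational
  open import Data.Rational.Properties
  import Data.Rational.Unnormalised as ℚᵘ
  import Data.Rational.Unnormalised.Properties as ℚᵘ
  open import Data.Rational.Base using (+-*-rawSemiring)
  open import Algebra.Definitions.RawSemiring +-*-rawSemiring using (_^_)
  open import Data.Rational.Solver using (module +-*-Solver)
  open import Data.Product using (_,_)
  open import Data.Sum using (inj₁; inj₂)
  open import Relation.Unary using (_∈_; _≐_)
  open import Relation.Nullary using (yes; no)
  open import Relation.Nullary.Decidable using (toWitness)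
  open import Relation.Binary.PropositionalEquality

  fromℕ-mono-< : ∀ {m n} → m ℕ.< n → fromℕ m < fromℕ n
  fromℕ-mono-< m<n = *<* (ℤ.*-monoʳ-<-pos (+ 1) (ℤ.+<+ m<n))

  fromℕ-mono-≤ : ∀ {m n} → m ℕ.≤ n → fromℕ m ≤ fromℕ n
  fromℕ-mono-≤ m≤n = *≤* (ℤ.*-monoʳ-≤-nonNeg (+ 1) (ℤ.+≤+ m≤n))

  fromℕ-+ : ∀ m n → fromℕ (m ℕ.+ n) ≡ fromℕ m + fromℕ n
  fromℕ-+ m n = toℚᵘ-injective (ℚᵘ.≃-trans
    (ℚᵘ.*≡* (cong (ℤ._* + 1) (sym (cong₂ ℤ._+_ (ℤ.*-identityʳ (+ m)) (ℤ.*-identityʳ (+ n))))))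
    (ℚᵘ.≃-sym (toℚᵘ-homo-+ (fromℕ m) (fromℕ n))))

  fromℕ-* : ∀ m n → fromℕ (m ℕ.* n) ≡ fromℕ m * fromℕ n
  fromℕ-* m n = toℚᵘ-injective (ℚᵘ.≃-trans
    (ℚᵘ.*≡* (cong (ℤ._* + 1) (ℤ.pos-* m n)))
    (ℚᵘ.≃-sym (toℚᵘ-homo-* (fromℕ m) (fromℕ n))))

  fromℕ-^ : ∀ m n → fromℕ (m ℕ.^ n) ≡ fromℕ m ^ n
  fromℕ-^ m zero    = refl
  fromℕ-^ m (suc n) = trans (fromℕ-* m (m ℕ.^ n)) (cong (fromℕ m *_) (fromℕ-^ m n))

  -- If `n ^ b < m ^ a`, the rational `n` itself lies in the left cut, hence below `n`, which is
  -- absurd.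
  ^[/]≤⇒^≤^ : ∀ m a b n → m ^[ a / b ] ≤ᴿ ⟦ n ⟧ → m ℕ.^ a ℕ.≤ n ℕ.^ b
  ^[/]≤⇒^≤^ m a b n h = ℕ.≮⇒≥ λ nᵇ<mᵃ → <-irrefl refl
    (h (inj₂ (subst (_< fromℕ (m ℕ.^ a)) (fromℕ-^ n b) (fromℕ-mono-< nᵇ<mᵃ))))

  square-mono-≤ : ∀ {x y} → 0ℚ ≤ x → x ≤ y → x * x ≤ y * y
  square-mono-≤ {x} {y} 0≤x x≤y = ≤-trans
    (*-monoˡ-≤-nonNeg x {{nonNegative 0≤x}} x≤y)
    (*-monoʳ-≤-nonNeg y {{nonNegative (≤-trans 0≤x x≤y)}} x≤y)

  square-mono-< : ∀ {x y} → 0ℚ ≤ x → x < y → x * x < y * y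
  square-mono-< {x} {y} 0≤x x<y = ≤-<-trans
    (*-monoˡ-≤-nonNeg x {{nonNegative 0≤x}} (<⇒≤ x<y))
    (*-monoˡ-<-pos y {{positive (≤-<-trans 0≤x x<y)}} x<y)

  ^2≡* : ∀ x → x ^ 2 ≡ x * x
  ^2≡* x = cong (x *_) (*-identityʳ x)

  -- Here `y` is a rational lower bound for the root. A negative `x` lies in the cut by definition;
  -- for the others squaring preserves the order.
  <⇒∈√ : ∀ m {x y} → y * y ≤ fromℕ (m ℕ.^ 1) → x < y → x ∈ √ m
  <⇒∈√ m {x} {y} y²≤m x<y with x <? 0ℚ
  ... | yes x<0 = inj₁ x<0
  ... | no  x≮0 = inj₂ (subst (_< fromℕ (m ℕ.^ 1)) (sym (^2≡* x))
                    (<-≤-trans (square-mono-< (≮⇒≥ x≮0) x<y) y²≤m))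

  ∈√⇒< : ∀ m {x y} → 0ℚ ≤ y → fromℕ (m ℕ.^ 1) ≤ y * y → x ∈ √ m → x < y
  ∈√⇒< m 0≤y m≤y² (inj₁ x<0) = <-≤-trans x<0 0≤y
  ∈√⇒< m {x} {y} 0≤y m≤y² (inj₂ x²<m) = ≰⇒> λ y≤x → <-irrefl refl (<-≤-trans
    (subst (_< fromℕ (m ℕ.^ 1)) (^2≡* x) x²<m) (≤-trans m≤y² (square-mono-≤ 0≤y y≤x)))

  open +-*-Solver using (solve; con; _:=_; _:+_; _:*_; _:-_)

  -- A rational lower bound for `√7` suffices: `(5/2)² ≤ 7` and `11 + 4 * 5/2 = 21`, so for `P ≤ 21`
  -- every `r < P` would lie in the cut on the left.
  11+4√7<⇒22≤ : ∀ P → √ 7 ⊛ 4 ⊕ 11 <ᴿ ⟦ P ⟧ → 22 ℕ.≤ P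
  11+4√7<⇒22≤ P (r , r∉ , r<P) = ℕ.≮⇒≥ λ { (s≤s P≤21) → r∉
    ((r - fromℕ 11) , (s , (<⇒∈√ 7 {y = + 5 / 2} (toWitness {a? = (+ 5 / 2) * (+ 5 / 2) ≤? fromℕ 7} _)
      (*-monoˡ-<-pos (+ 1 / 4) (+-monoˡ-< (- fromℕ 11) (<-≤-trans r<P (fromℕ-mono-≤ P≤21)))) ,
      (begin
        r - fromℕ 11                              ≡⟨ *-identityʳ _ ⟨
        (r - fromℕ 11) * 1ℚ                       ≡⟨⟩
        (r - fromℕ 11) * ((+ 1 / 4) * fromℕ 4)    ≡⟨ *-assoc (r - fromℕ 11) (+ 1 / 4) (fromℕ 4) ⟨
        s * fromℕ 4                               ∎))) ,
     solve 2 (λ r t → r := (r :- t) :+ t) refl r (fromℕ 11)) }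
    where
    open ≡-Reasoning
    s = (r - fromℕ 11) * (+ 1 / 4)

  -- y < u ⇔ (y - 1) c + 1 < (u - 1) c + 1.
  square-root-cut : ∀ m u c → .{{ℕ.NonZero c}} → u ℕ.* u ≡ m →
    ∀ N → N ℕ.+ c ≡ u ℕ.* c ℕ.+ 1 → ⟦ N ⟧ ≐ (√ m ⊖ 1) ⊛ c ⊕ 1
  square-root-cut m u c@(suc _) refl N N+c≡ = to , from
    where
    u²≡ : fromℕ (m ℕ.^ 1) ≡ fromℕ u * fromℕ u
    u²≡ = trans (cong fromℕ (ℕ.^-identityʳ m)) (fromℕ-* u u)
    affine : ℚ → ℚ
    affine x = (x - 1ℚ) * fromℕ c + 1ℚ
    -- The hypothesis on `N` avoids `u - 1` on the naturals by adding `c` to both sides; cancelling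
    -- `c` in `ℚ` recovers the affine form.
    N≡ : fromℕ N ≡ affine (fromℕ u)
    N≡ = +-cancelʳ (fromℕ c) (fromℕ N) _ (begin
      fromℕ N + fromℕ c                  ≡⟨ fromℕ-+ N c ⟨
      fromℕ (N ℕ.+ c)                    ≡⟨ cong fromℕ N+c≡ ⟩
      fromℕ (u ℕ.* c ℕ.+ 1)              ≡⟨ fromℕ-+ (u ℕ.* c) 1 ⟩
      fromℕ (u ℕ.* c) + 1ℚ               ≡⟨ cong (_+ 1ℚ) (fromℕ-* u c) ⟩
      fromℕ u * fromℕ c + 1ℚ
                                         ≡⟨ solve 2 (λ u c → u :* c :+ con 1ℚ
                                              := (u :- con 1ℚ) :* c :+ con 1ℚ :+ c) refl (fromℕ u) (fromℕ c) ⟩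
      affine (fromℕ u) + fromℕ c         ∎)
      where
      open ≡-Reasoning
      open import Algebra.Properties.Group +-0-group using () renaming (∙-cancelʳ to +-cancelʳ)
    from : ∀ {r} → r ∈ (√ m ⊖ 1) ⊛ c ⊕ 1 → r < fromℕ N
    from (_ , (_ , (x , x∈ , refl) , refl) , refl) = subst (affine x <_) (sym N≡)
      (+-monoˡ-< 1ℚ (*-monoˡ-<-pos (fromℕ c) (+-monoˡ-< (- 1ℚ)
        (∈√⇒< m (fromℕ-mono-≤ {0} {u} z≤n) (≤-reflexive u²≡) x∈))))
    to : ∀ {r} → r < fromℕ N → r ∈ (√ m ⊖ 1) ⊛ c ⊕ 1
    to {r} r<N = _ , (_ , (x , <⇒∈√ m (≤-reflexive (sym u²≡)) x<u , refl) , refl) , r≡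
      where
      -- The preimage of `r` under `affine`, which is invertible since `c` is nonzero.
      x = (r - 1ℚ) * 1/ fromℕ c + 1ℚ
      r≡ : r ≡ affine x
      r≡ = sym (begin
        ((r - 1ℚ) * 1/ fromℕ c + 1ℚ - 1ℚ) * fromℕ c + 1ℚ
          ≡⟨ solve 3 (λ r i c → ((r :- con 1ℚ) :* i :+ con 1ℚ :- con 1ℚ) :* c :+ con 1ℚ
                       := (r :- con 1ℚ) :* (i :* c) :+ con 1ℚ) refl r (1/ fromℕ c) (fromℕ c) ⟩
        (r - 1ℚ) * (1/ fromℕ c * fromℕ c) + 1ℚ
          ≡⟨ cong (λ t → (r - 1ℚ) * t + 1ℚ) (*-inverseˡ (fromℕ c)) ⟩
        (r - 1ℚ) * 1ℚ + 1ℚ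
          ≡⟨ solve 1 (λ r → (r :- con 1ℚ) :* con 1ℚ :+ con 1ℚ := r) refl r ⟩
        r ∎)
        where open ≡-Reasoning
      x<u : x < fromℕ u
      x<u = ≰⇒> λ u≤x → <-irrefl refl (<-≤-trans r<N (subst₂ _≤_ (sym N≡) (sym r≡)
        (+-monoˡ-≤ 1ℚ (*-monoʳ-≤-nonNeg (fromℕ c) (+-monoˡ-≤ (- 1ℚ) u≤x)))))

-- From a prime divisor `q ≡ 1` modulo `P` to the excluded values of `N`.

open import Defs
open import Data.Nat using (ℕ; _+_; _*_; _∸_; _^_; _≤_; _≥_)
open import Data.Nat.Primality using (Prime)
open import Data.Integer using (ℤ; 1ℤ)
import Data.Integer as ℤ
open import Data.Product using (_×_; ∃₂)
open import Relation.Nullary using (¬_)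
open import Relation.Binary.PropositionalEquality using (_≡_; _≢_)

open import Data.Nat using (NonZero; zero; suc; _<_; s≤s; >-nonZero; nonTrivial⇒n>1; nonTrivial⇒≢1)
open import Data.Nat.Properties
open import Data.Nat.Divisibility using (_∣_; divides; ∣m+n∣m⇒∣n; ∣1⇒≡1; m∣m*n; n∣m*n; ∣-trans)
open import Data.Nat.Primality using (prime?; prime⇒nonZero; prime⇒nonTrivial)
open import Data.Nat.Tactic.RingSolver using (solve-∀)
open import Data.Integer using (+_; -[1+_])
open import Data.Product using (_,_)
open import Data.Sum using (inj₁; inj₂)
open import Relation.Nullary using (contradiction)
open import Relation.Nullary.Decidable using (decidable-stable)
open import Relation.Binary.PropositionalEquality using (refl; sym; trans; cong; subst; module ≡-Reasoning)
open Congruence using (_≈_[mod_]; mod; module _≈_[mod_]; ≈-sym; ≈-trans; ^-cong; ∃-prime-factor-≡1)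
open Factorisation using (Exceptional; factorisation⇒exceptional)
open RealCut using (^[/]≤⇒^≤^; 11+4√7<⇒22≤; square-root-cut)

^-reflects-≤ : ∀ {p m n} → 1 < p → p ^ m ≤ p ^ n → m ≤ n
^-reflects-≤ {p} 1<p h = ≮⇒≥ λ n<m → <⇒≱ (^-monoʳ-< p 1<p n<m) h

∤1+* : ∀ {p} m → Prime p → ¬ p ∣ p * m + 1
∤1+* {p} m pr h = contradiction (∣1⇒≡1 (∣m+n∣m⇒∣n h (m∣m*n m))) (nonTrivial⇒≢1 {{prime⇒nonTrivial pr}})

-- A proper divisor q ≡ 1 (mod P) of 1 + M P³ has a cofactor ≡ 1 (mod P) as well.
proper-divisor⇒exceptional : ∀ {M P q} (M≥1 : M ≥ 1) (M²≤P : M * M ≤ P) (P≥22 : P ≥ 22) →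
  q ∣ M * (P * P * P) + 1 → q ≢ M * (P * P * P) + 1 → q ≢ 1 → P ∣ q ∸ 1 → Exceptional M≥1 M²≤P P≥22
proper-divisor⇒exceptional {M} {P} {q} M≥1 M²≤P P≥22 (divides r N≡rq) q≢N q≢1 P∣q-1 =
  go q r N≡rq q≢N q≢1 P∣q-1
  where
  N = M * (P * P * P) + 1
  go : ∀ q r → N ≡ r * q → q ≢ N → q ≢ 1 → P ∣ q ∸ 1 → Exceptional M≥1 M²≤P P≥22
  go q       zero    N≡ _ _ _ = contradiction (trans (+-comm 1 _) N≡) λ ()
  go zero    (suc r) N≡ _ _ _ = contradiction (trans (+-comm 1 _) (trans N≡ (*-zeroʳ (suc r)))) λ ()
  go (suc _) (suc r) N≡ q≢N q≢1 (divides h refl) with P∣r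
    where
    -- Since `q = 1 + h P` and the cofactor is `suc r`, taking 1 from both expressions for `N`
    -- exhibits `r` as a difference of multiples of `P`.
    r+≡ : suc r * (h * P) + r ≡ M * (P * P) * P
    r+≡ = suc-injective (trans (e₁ r (h * P)) (trans (sym N≡) (e₂ M P)))
      where
      e₁ : ∀ r t → suc (suc r * t + r) ≡ suc r * suc t
      e₁ = solve-∀
      e₂ : ∀ m p → m * (p * p * p) + 1 ≡ suc (m * (p * p) * p)
      e₂ = solve-∀
    P∣r : P ∣ r
    P∣r = ∣m+n∣m⇒∣n (subst (P ∣_) (sym r+≡) (n∣m*n (M * (P * P)))) (∣-trans (n∣m*n h) (n∣m*n (suc r)))
  ... | divides g refl = factorisation⇒exceptional M≥1 M²≤P P≥22 g h
    -- A cofactor 1 would mean `q = N`, and `h = 0` would mean `q = 1`.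
    (n≢0⇒n>0 λ { refl → q≢N (trans (sym (*-identityˡ _)) (sym N≡)) })
    (n≢0⇒n>0 λ { refl → q≢1 refl })
    (trans (sym N≡) (+-comm _ 1))

theorem3p4 : ∀ (p K n j N : ℕ) → Prime p → K ≥ 1 → n ≥ 1 → j ≤ n ∸ 1 →
  N ≡ K * p ^ n + 1 →
  N ≢ p ^ (3 * (n ∸ j)) + 1 →
  ⟦ N ⟧ ≉ᴿ (√ (p ^ (n ∸ j) + 1) ⊖ 1) ⊛ p ^ (3 * (n ∸ j)) ⊕ 1 →
  (∀ (H : ℕ) → H ≥ 1 → N ≢ H ^ 3 * p ^ (3 * (n ∸ j)) + 1) →
  p ^ j ≥ p ^ (2 * (n ∸ j)) →
  (N ∸ 1) ^[ 2 / 7 ] ≤ᴿ ⟦ p ^ (n ∸ j) ⟧ →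
  √ 7 ⊛ 4 ⊕ 11 <ᴿ ⟦ p ^ (n ∸ j) ⟧ →
  (∃₂ λ (a L : ℤ) →
    1ℤ ℤ.< a ×
    (a ℤ.^ (K * p ^ (n ∸ j ∸ 1)) ≡ L [mod N ]) ×
    ¬ (L ≡ 1ℤ [mod N ]) ×
    (L ℤ.^ (p ^ (j + 1)) ≡ 1ℤ [mod N ])) →
  Prime N
-- A negative base contradicts `1 < a`; Fermat's theorem above treats natural bases.
theorem3p4 p K n j N _ _ _ _ _ _ _ _ _ _ _ (-[1+ _ ] , _ , () , _)
theorem3p4 p K n j N p-prime K≥1 n≥1 j≤n-1 refl _ N≉√ N≢H³ pʲ≥p²ᵈ P≥N²ᐟ⁷ P>
  (+ a , L , _ , aᴱ≡L , L≢1 , Lᵖ≡1) =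
  decidable-stable (prime? N) λ N-composite →
    -- With `e = d - 1`, divisibility of `q - 1` by `p ^ suc e` is divisibility by `P`.
    let q , q-prime , q∣N , pᵈ∣q-1 = ∃-prime-factor-≡1 a K e (j + 1) {{>-nonZero K≥1}} N≢0 p-prime p∤N
          (λ h → L≢1 (unmod (≈-trans (≈-sym (mod {N = N} aᴱ≡L)) h)))
          (≈-trans (^-cong (p ^ (j + 1)) (mod aᴱ≡L)) (mod Lᵖ≡1))
    in exceptional-absurd (proper-divisor⇒exceptional M≥1 M²≤P P≥22
         (subst (q ∣_) N≡ q∣N)
         (λ q≡N → N-composite (subst Prime (trans q≡N (sym N≡)) q-prime))
         (nonTrivial⇒≢1 {{prime⇒nonTrivial q-prime}})
         (subst (λ k → p ^ k ∣ q ∸ 1) (sym d≡1+e) pᵈ∣q-1))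
  where
  open _≈_[mod_]
  instance
    p≢0 : NonZero p
    p≢0 = prime⇒nonZero p-prime
  d = n ∸ j
  e = d ∸ 1
  P = p ^ d
  -- Chosen so that `N - 1 = M P³`: `n = (j - 2 d) + 3 d`, where `2d≤j` makes the truncated
  -- difference exact.
  M = K * p ^ (j ∸ 2 * d)

  j<n : j < n
  j<n = ≤-trans (s≤s j≤n-1) (≤-reflexive (m+[n∸m]≡n n≥1))

  d≡1+e : d ≡ suc e
  d≡1+e = sym (m+[n∸m]≡n (m<n⇒0<n∸m j<n))

  2d≤j : 2 * d ≤ j
  2d≤j = ^-reflects-≤ (nonTrivial⇒n>1 p {{prime⇒nonTrivial p-prime}}) pʲ≥p²ᵈ

  n≡ : n ≡ (j ∸ 2 * d) + 3 * d
  n≡ = begin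
    n                              ≡⟨ m+[n∸m]≡n (<⇒≤ j<n) ⟨
    j + d                          ≡⟨ cong (_+ d) (m∸n+n≡m 2d≤j) ⟨
    (j ∸ 2 * d) + 2 * d + d        ≡⟨ eq (j ∸ 2 * d) d ⟩
    (j ∸ 2 * d) + 3 * d            ∎
    where
    open ≡-Reasoning
    eq : ∀ i d → i + 2 * d + d ≡ i + 3 * d
    eq = solve-∀

  p³ᵈ≡ : p ^ (3 * d) ≡ P * P * P
  p³ᵈ≡ = begin
    p ^ (3 * d)       ≡⟨ cong (p ^_) (*-comm 3 d) ⟩
    p ^ (d * 3)       ≡⟨ ^-*-assoc p d 3 ⟨
    P ^ 3             ≡⟨ eq P ⟩
    P * P * P         ∎
    where
    open ≡-Reasoning
    eq : ∀ x → x * (x * (x * 1)) ≡ x * x * x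
    eq = solve-∀

  N-1≡ : K * p ^ n ≡ M * p ^ (3 * d)
  N-1≡ = begin
    K * p ^ n                                ≡⟨ cong (λ k → K * p ^ k) n≡ ⟩
    K * p ^ ((j ∸ 2 * d) + 3 * d)            ≡⟨ cong (K *_) (^-distribˡ-+-* p (j ∸ 2 * d) (3 * d)) ⟩
    K * (p ^ (j ∸ 2 * d) * p ^ (3 * d))      ≡⟨ *-assoc K _ _ ⟨
    M * p ^ (3 * d)                          ∎
    where open ≡-Reasoning

  N≡ : N ≡ M * (P * P * P) + 1
  N≡ = cong (_+ 1) (trans N-1≡ (cong (M *_) p³ᵈ≡))

  N≢0 : N ≢ 0
  N≢0 h = contradiction (trans (+-comm 1 _) h) λ ()

  p∤N : ¬ p ∣ N
  p∤N h = ∤1+* (K * p ^ (n ∸ 1)) p-prime (subst (p ∣_) (cong (_+ 1) (begin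
    K * p ^ n                 ≡⟨ cong (λ k → K * p ^ k) (m+[n∸m]≡n n≥1) ⟨
    K * (p * p ^ (n ∸ 1))     ≡⟨ eq K p (p ^ (n ∸ 1)) ⟩
    p * (K * p ^ (n ∸ 1))     ∎)) h)
    where
    open ≡-Reasoning
    eq : ∀ k p x → k * (p * x) ≡ p * (k * x)
    eq = solve-∀

  P≥22 : P ≥ 22
  P≥22 = 11+4√7<⇒22≤ P P>

  M≥1 : M ≥ 1
  M≥1 = *-mono-≤ K≥1 (m^n>0 p (j ∸ 2 * d))

  -- The real bound says `(M P³)² ≤ P ^ 7`, from which `P ^ 6` cancels.
  M²≤P : M * M ≤ P
  M²≤P = *-cancelʳ-≤ (M * M) P (P ^ 6) {{m^n≢0 P 6 {{m^n≢0 p d}}}} (begin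
    M * M * P ^ 6             ≡⟨ eq M P ⟩
    (M * (P * P * P)) ^ 2     ≡⟨ cong (_^ 2) (trans (sym (m+n∸n≡m (M * (P * P * P)) 1)) (cong (_∸ 1) (sym N≡))) ⟩
    (N ∸ 1) ^ 2               ≤⟨ ^[/]≤⇒^≤^ (N ∸ 1) 2 7 P P≥N²ᐟ⁷ ⟩
    P ^ 7                     ∎)
    where
    open ≤-Reasoning
    eq : ∀ m x → m * m * (x * (x * (x * (x * (x * (x * 1)))))) ≡ (m * (x * x * x)) * ((m * (x * x * x)) * 1)
    eq = solve-∀

  exceptional-absurd : ¬ Exceptional M≥1 M²≤P P≥22
  exceptional-absurd (inj₁ (H , H≥1 , M≡H³)) = N≢H³ H H≥1 (begin
    K * p ^ n + 1               ≡⟨ cong (_+ 1) N-1≡ ⟩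
    M * p ^ (3 * d) + 1         ≡⟨ cong (λ m → m * p ^ (3 * d) + 1) (trans M≡H³ (eq H)) ⟩
    H ^ 3 * p ^ (3 * d) + 1     ∎)
    where
    open ≡-Reasoning
    eq : ∀ x → x * x * x ≡ x * (x * (x * 1))
    eq = solve-∀
  -- The integer root of `P + 1` is `suc M` and the scale is `p ^ (3 * d)`, so `⟦ N ⟧` would be the
  -- excluded cut.
  exceptional-absurd (inj₂ [1+M]²≡P+1) = N≉√ (square-root-cut (P + 1) (suc M) (p ^ (3 * d))
    {{m^n≢0 p (3 * d)}} [1+M]²≡P+1 N
    (trans (cong (λ k → k + 1 + p ^ (3 * d)) N-1≡) (eq M (p ^ (3 * d)))))
    where
    eq : ∀ m c → m * c + 1 + c ≡ suc m * c + 1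
    eq = solve-∀
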